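{- Let $p$ be a prime number. There exist integers $a$ and $b$ such that $p=a^2+ab+b^2$ if and only if $p=3$ or $p\equiv 1 \pmod{3}$. -}

module Defs where

{-# OPTIONS --safe #-}

-- Modulo p, the map x ↦ -1/(x+1) has order 3 on the p - 2 residues other than
-- 0 and -1. If p ≡ 1 (mod 3), then 3 ∤ p - 2, so it has a fixed point, that is,
-- p divides some x² + x + 1. Reducing the form p X² + (2x+1) XY + c Y² of
-- discriminant -3, where p c = x² + x + 1, then gives p = u² + uv + v².
-- Conversely a² + ab + b² = (a - b)² + 3ab is a square modulo 3.

module Submission where

open import Defs
open import Data.Product using (_×_; _,_; ∃-syntax)
open import Data.Sum using (_⊎_; inj₁; inj₂; [_,_])
open import Data.List using (List; []; _∷_; _++_; length; applyUpTo)
open import Data.List.Properties using (length-applyUpTo)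
open import Data.List.Membership.Propositional using (_∈_; find; lose)
open import Data.List.Membership.Propositional.Properties
  using (∈-∃++; ∈-applyUpTo⁺; ∈-applyUpTo⁻)
open import Data.List.Relation.Unary.All using (lookup; _∷_)
open import Data.List.Relation.Unary.AllPairs using (_∷_)
open import Data.List.Relation.Unary.Any using (Any; any?; here; there)
open import Data.List.Relation.Unary.Unique.Propositional using (Unique)
open import Data.List.Relation.Unary.Unique.Propositional.Properties using (applyUpTo⁺₁)
open import Data.List.Relation.Binary.Permutation.Propositional
  using (_↭_; prep; ↭-sym; ↭-trans; ↭-reflexive; ↭⇒↭ₛ)
open import Data.List.Relation.Binary.Permutation.Propositional.Properties
  using (∈-resp-↭; shift; ↭-length)
open import Data.List.Relation.Binary.Permutation.Setoid.Properties using (Unique-resp-↭)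
open import Function using (_∘_; id)
open import Level using (Level)
open import Relation.Binary using (Rel)
open import Relation.Binary.PropositionalEquality
  using (_≢_; refl; sym; trans; cong; cong₂; subst; setoid; module ≡-Reasoning)
open import Relation.Nullary using (¬_; Dec; yes; no; contradiction)

module NaturalNumbers where

  open import Data.Nat
  open import Data.Nat.Coprimality using (Coprime; coprime-Bézout; prime⇒coprime)
  import Data.Nat.Coprimality as Coprimality
  open import Data.Nat.Divisibility
  open import Data.Nat.DivMod
  open import Data.Nat.GCD using (module Bézout)
  open import Data.Nat.Primality
  open import Data.Nat.Properties
  open import Data.Nat.Tactic.RingSolver using (solve-∀)
  open import Relation.Binary.PropositionalEquality using (_≡_)

  private variable
    a ℓ : Level
    A : Set a
    m n p x y z : ℕ

  -- Counting by cycles of length three.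

  ∈⇒↭∷ : ∀ {x : A} {xs} → x ∈ xs → ∃[ ys ] xs ↭ x ∷ ys
  ∈⇒↭∷ {x = x} x∈xs with ys , zs , eq ← ∈-∃++ x∈xs =
    ys ++ zs , ↭-trans (↭-reflexive eq) (shift x ys zs)

  ∈-tail : ∀ {x y : A} {xs} → x ≢ y → x ∈ y ∷ xs → x ∈ xs
  ∈-tail x≢y (here x≡y)   = contradiction x≡y x≢y
  ∈-tail x≢y (there x∈xs) = x∈xs

  module _ {A : Set a} {_R_ : Rel A ℓ}
           (cyclic : ∀ {x y z} → x R y → y R z → z R x) where

    -- With `functional` and `total`, `cyclic` makes the relation a map whose third iterate is the
    -- identity. Without fixed points, `x`, its image `y` and the image `z` of `y` are distinct and
    -- form a cycle; removing it leaves a list with the same properties. The bound `n` serves the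
    -- recursion, since `ys` is no sublist term of `xs`.
    3∣length : ∀ n (xs : List A) → length xs ≤ n → Unique xs →
               (∀ {x} → x ∈ xs → ¬ x R x) →
               (∀ {x} → x ∈ xs → ∃[ y ] y ∈ xs × x R y) →
               (∀ {x y z} → y ∈ xs → z ∈ xs → x R y → x R z → y ≡ z) →
               3 ∣ length xs
    3∣length n []       _ _ _ _ _ = 3 ∣0
    3∣length (suc n) xs@(x ∷ xs₁) (s≤s len) uniq irrefl total functional
      with y , y∈ , xRy ← total (here refl)
      with z , z∈ , yRz ← total y∈
      = go
      where
      zRx : z R x
      zRx = cyclic xRy yRz

      y≢x : y ≢ x
      y≢x refl = irrefl (here refl) xRy

      z≢y : z ≢ y
      z≢y refl = irrefl y∈ yRz

      z≢x : z ≢ x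
      z≢x refl = irrefl (here refl) zRx

      -- If `w R t`, then `cyclic` makes both `u` and `v` images of `t`.
      injective : ∀ {u v w} → u ∈ xs → v ∈ xs → w ∈ xs → u R w → v R w → u ≡ v
      injective u∈ v∈ w∈ uRw vRw with t , _ , wRt ← total w∈ =
        functional u∈ v∈ (cyclic uRw wRt) (cyclic vRw wRt)

      go : 3 ∣ length xs
      go
        with ys₁ , σ₁ ← ∈⇒↭∷ (∈-tail y≢x y∈)
        with ys , σ₂ ← ∈⇒↭∷ (∈-tail z≢y (∈-resp-↭ σ₁ (∈-tail z≢x z∈)))
        = subst (3 ∣_) (sym (↭-length σ))
            (∣m∣n⇒∣m+n (∣-refl {3}) (3∣length n ys len′ uniq′
              (irrefl ∘ sub) total′ (λ v∈ w∈ → functional (sub v∈) (sub w∈))))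
        where
        σ : xs ↭ x ∷ y ∷ z ∷ ys
        σ = prep x (↭-trans σ₁ (prep y σ₂))

        sub : ∀ {w} → w ∈ ys → w ∈ xs
        sub = ∈-resp-↭ (↭-sym σ) ∘ there ∘ there ∘ there

        uniqσ : Unique (x ∷ y ∷ z ∷ ys)
        uniqσ = Unique-resp-↭ (setoid A) (↭⇒↭ₛ σ) uniq

        uniq′ : Unique ys
        uniq′ with _ ∷ _ ∷ _ ∷ u ← uniqσ = u

        len′ : length ys ≤ n
        len′ = ≤-trans (m≤n+m _ 2)
          (subst (_≤ n) (↭-length (↭-trans σ₁ (prep y σ₂))) len)

        -- The image of `w` stays in `ys`: the elements `x`, `y`, `z` are already the images of `z`,
        -- `x`, `y`, all different from `w`.
        total′ : ∀ {w} → w ∈ ys → ∃[ v ] v ∈ ys × w R v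
        total′ {w} w∈
          with (_ ∷ _ ∷ x#) ∷ (_ ∷ y#) ∷ z# ∷ _ ← uniqσ
          with v , v∈ , wRv ← total (sub w∈)
          with ∈-resp-↭ σ v∈
        ... | here refl =
          contradiction (injective z∈ (sub w∈) v∈ zRx wRv) (lookup z# w∈)
        ... | there (here refl) =
          contradiction (injective (here refl) (sub w∈) v∈ xRy wRv) (lookup x# w∈)
        ... | there (there (here refl)) =
          contradiction (injective y∈ (sub w∈) v∈ yRz wRv) (lookup y# w∈)
        ... | there (there (there v∈ys)) = v , v∈ys , wRv

  -- The map of order three on residues modulo p.

  -- x ∼[ p ] y says that y ≡ -1/(x+1) modulo p.
  _∼[_]_ : ℕ → ℕ → ℕ → Set
  x ∼[ p ] y = p ∣ x * y + y + 1

  -- The identity yields p ∣ y(zx + x + 1), and p cannot divide y, since it would then divide 1 by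
  -- `x∼y`.
  ∼-cyclic : Prime p → x ∼[ p ] y → y ∼[ p ] z → z ∼[ p ] x
  ∼-cyclic {p} {x} {y} {z} pr x∼y y∼z with euclidsLemma y (z * x + x + 1) pr p∣y*
    where
    identity : ∀ x y z → (z + 1) * (x * y + y + 1) ≡
                         (y * z + z + 1) + y * (z * x + x + 1)
    identity = solve-∀

    p∣y* : p ∣ y * (z * x + x + 1)
    p∣y* = ∣m+n∣m⇒∣n (subst (p ∣_) (identity x y z) (∣n⇒∣m*n (z + 1) x∼y)) y∼z
  ... | inj₂ z∼x = z∼x
  ... | inj₁ p∣y = contradiction (subst Prime (∣1⇒≡1 p∣1) pr) ¬prime[1]
    where
    p∣1 : p ∣ 1
    p∣1 = ∣m+n∣m⇒∣n x∼y (∣m∣n⇒∣m+n (∣n⇒∣m*n x p∣y) p∣y)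

  ∣∧<⇒≡0 : p ∣ n → n < p → n ≡ 0
  ∣∧<⇒≡0 {n = zero}  _   _   = refl
  ∣∧<⇒≡0 {n = suc _} p∣n n<p = contradiction p∣n (>⇒∤ n<p)

  ∣m∣n⇒∣∣m-n∣ : p ∣ m → p ∣ n → p ∣ ∣ m - n ∣
  ∣m∣n⇒∣∣m-n∣ {p} (divides-refl j) (divides-refl k) =
    divides ∣ j - k ∣ (sym (*-distribʳ-∣-∣ p j k))

  -- The multiples z(xy + y + 1) and y(xz + z + 1) of p differ by |y - z|, which is less than p.
  ∼-functional : y < p → z < p → x ∼[ p ] y → x ∼[ p ] z → y ≡ z
  ∼-functional {y} {p} {z} {x} y<p z<p x∼y x∼z = ∣m-n∣≡0⇒m≡n (∣∧<⇒≡0 p∣∣y-z∣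
    (≤-<-trans (∣m-n∣≤m⊔n y z) (⊔-lub y<p z<p)))
    where
    expand : ∀ x y z → z * (x * y + y + 1) ≡ (x * y * z + y * z) + z
    expand = solve-∀

    expand′ : ∀ x y z → y * (x * z + z + 1) ≡ (x * y * z + y * z) + y
    expand′ = solve-∀

    p∣∣y-z∣ : p ∣ ∣ y - z ∣
    p∣∣y-z∣ = subst (p ∣_)
      (trans (cong₂ ∣_-_∣ (expand′ x y z) (expand x y z)) (∣m+n-m+o∣≡∣n-o∣ (x * y * z + y * z) y z))
      (∣m∣n⇒∣∣m-n∣ (∣n⇒∣m*n y x∼z) (∣n⇒∣m*n z x∼y))

  -1/suc : Coprime (suc x) (suc n) → ∃[ s ] x ∼[ suc n ] s
  -1/suc {x} {n} c with coprime-Bézout c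
  ... | Bézout.-+ s k eq = s , divides k (trans (identity x s) eq)
    where
    identity : ∀ x s → x * s + s + 1 ≡ 1 + s * suc x
    identity = solve-∀
  -- Here `s` inverts x + 1, and n ≡ -1 modulo n + 1 supplies the sign.
  ... | Bézout.+- s k eq = s * n , divides (1 + n * k) (begin
    x * (s * n) + s * n + 1     ≡⟨ identity x s n ⟩
    1 + n * (s * suc x)         ≡⟨ cong (λ t → 1 + n * t) eq ⟨
    1 + n * (1 + k * suc n)     ≡⟨ identity′ n k ⟩
    (1 + n * k) * suc n         ∎)
    where
    open ≡-Reasoning
    identity : ∀ x s n → x * (s * n) + s * n + 1 ≡ 1 + n * (s * suc x)
    identity = solve-∀
    identity′ : ∀ n k → 1 + n * (1 + k * suc n) ≡ (1 + n * k) * suc n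
    identity′ = solve-∀

  ∼-% : ∀ {s} .{{_ : NonZero p}} → x ∼[ p ] s → x ∼[ p ] (s % p)
  ∼-% {p} {x} {s} x∼s = ∣m+n∣m⇒∣n
    (subst (p ∣_) (trans (cong (λ t → x * t + t + 1) (m≡m%n+[m/n]*n s p))
                         (identity x (s % p) (s / p) p)) x∼s)
    (n∣m*n (suc x * (s / p)))
    where
    identity : ∀ x r q p → x * (r + q * p) + (r + q * p) + 1 ≡
                           suc x * q * p + (x * r + r + 1)
    identity = solve-∀

  ∼-total : Prime (2 + n) → ∀ i → i < n →
            ∃[ j ] j < n × suc i ∼[ 2 + n ] suc j
  ∼-total {n} pr i i<n
    with s , x∼s ← -1/suc {suc i} (Coprimality.sym (prime⇒coprime pr (s<s (s<s i<n))))
    = in-range (s % (2 + n)) (m%n<n s (2 + n)) (∼-% {2 + n} {suc i} {s} x∼s)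
    where
    identity : ∀ i n → (suc i * suc n + suc n + 1) + suc i ≡ (2 + i) * (2 + n)
    identity = solve-∀

    in-range : ∀ y → y < 2 + n → suc i ∼[ 2 + n ] y →
               ∃[ j ] j < n × suc i ∼[ 2 + n ] suc j
    -- The value 0 would make p divide 1.
    in-range zero _ x∼0 =
      contradiction (∣1⇒≡1 (subst (2 + n ∣_) (cong (λ t → t + 0 + 1) (*-zeroʳ i)) x∼0)) λ ()
    in-range (suc j) (s<s j<1+n) x∼y with m≤n⇒m<n∨m≡n (s≤s⁻¹ j<1+n)
    ... | inj₁ j<n  = j , j<n , x∼y
    -- The value n + 1 ≡ -1 would make p divide `suc i`, which is positive and less than p.
    ... | inj₂ refl = contradiction
      (∣m+n∣m⇒∣n (divides (2 + i) (identity i n)) x∼y)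
      (>⇒∤ (s<s (m<n⇒m<1+n i<n)))

  -- A fixed point `x ∼[ 2 + n ] x` is by definition a divisibility of x² + x + 1. If none occurs
  -- among 1, ..., n, these n residues split into cycles of length three.
  ∣x²+x+1⊎3∣p-2 : Prime (2 + n) → (∃[ x ] 2 + n ∣ x * x + x + 1) ⊎ 3 ∣ n
  ∣x²+x+1⊎3∣p-2 {n} pr = by-search (any? (λ x → 2 + n ∣? x * x + x + 1) xs)
    where
    xs : List ℕ
    xs = applyUpTo suc n

    total : ∀ {x} → x ∈ xs → ∃[ y ] y ∈ xs × x ∼[ 2 + n ] y
    total x∈ with i , i<n , refl ← ∈-applyUpTo⁻ suc x∈ =
      let j , j<n , x∼y = ∼-total pr i i<n
      in  suc j , ∈-applyUpTo⁺ suc j<n , x∼y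

    bounded : ∀ {x} → x ∈ xs → x < 2 + n
    bounded x∈ with i , i<n , refl ← ∈-applyUpTo⁻ suc x∈ = s<s (m<n⇒m<1+n i<n)

    by-search : Dec (Any (λ x → x ∼[ 2 + n ] x) xs) →
                (∃[ x ] 2 + n ∣ x * x + x + 1) ⊎ 3 ∣ n
    by-search (yes found) with x , _ , p∣ ← find found = inj₁ (x , p∣)
    by-search (no none) = inj₂ (subst (3 ∣_) (length-applyUpTo suc n)
      (3∣length {_R_ = _∼[ 2 + n ]_} (λ {x} {y} {z} → ∼-cyclic {2 + n} {x} {y} {z} pr)
        (length xs) xs ≤-refl
        (applyUpTo⁺₁ suc n (λ i<j _ → <⇒≢ (s<s i<j)))
        (λ {x} x∈ x∼x → none (lose {P = λ x → x ∼[ 2 + n ] x} x∈ x∼x))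
        total
        (λ {x} {y} {z} y∈ z∈ → ∼-functional {y} {2 + n} {z} {x} (bounded y∈) (bounded z∈))))

  ∣x²+x+1 : Prime p → p % 3 ≡ 1 → ∃[ x ] p ∣ x * x + x + 1
  ∣x²+x+1 {0} pr _ = contradiction pr ¬prime[0]
  ∣x²+x+1 {1} pr _ = contradiction pr ¬prime[1]
  ∣x²+x+1 {suc (suc n)} pr p%3≡1 = [ id , absurd ] (∣x²+x+1⊎3∣p-2 pr)
    where
    absurd : 3 ∣ n → ∃[ x ] 2 + n ∣ x * x + x + 1
    absurd (divides k refl) =
      contradiction (trans (sym p%3≡1) ([m+kn]%n≡m%n 2 k 3)) λ ()

  -- Reduction of forms of discriminant -3.

  N : ℕ → ℕ → ℕ
  N u v = u * u + u * v + v * v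

  -- Two vectors of norms a and c whose inner product, for the bilinear form
  -- polarising N, is 2n+1: the form a X² + (2n+1) XY + c Y² is N in these coordinates.
  record Vectors (n a c : ℕ) : Set where
    constructor vectors
    field
      u v s t : ℕ
      norm₁ : a ≡ N u v
      norm₂ : c ≡ N s t
      inner : 2 * (u * s) + u * t + v * s + 2 * (v * t) ≡ 2 * n + 1

  Vectors-sym : ∀ {n a c} → Vectors n a c → Vectors n c a
  Vectors-sym (vectors u v s t e₁ e₂ e₃) =
    vectors s t u v e₂ e₁ (trans (identity u v s t) e₃)
    where
    identity : ∀ u v s t → 2 * (s * u) + s * v + t * u + 2 * (t * v) ≡
                           2 * (u * s) + u * t + v * s + 2 * (v * t)
    identity = solve-∀

  -- Adding the first vector to the second raises the inner product by twice the norm `a`.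
  Vectors-shear : ∀ {n a c} → Vectors n a c → Vectors (a + n) a (c + (2 * n + 1) + a)
  Vectors-shear {n} {a} {c} (vectors u v s t e₁ e₂ e₃) =
    vectors u v (u + s) (v + t) e₁
      (trans (cong₂ _+_ (cong₂ _+_ e₂ (sym e₃)) e₁) (identity u v s t))
      (trans (identity′ u v s t)
        (trans (cong₂ (λ i j → 2 * i + j) (sym e₁) e₃) (identity″ a n)))
    where
    identity : ∀ u v s t →
      (s * s + s * t + t * t) + (2 * (u * s) + u * t + v * s + 2 * (v * t))
        + (u * u + u * v + v * v)
      ≡ (u + s) * (u + s) + (u + s) * (v + t) + (v + t) * (v + t)
    identity = solve-∀
    identity′ : ∀ u v s t →
      2 * (u * (u + s)) + u * (v + t) + v * (u + s) + 2 * (v * (v + t)) ≡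
      2 * (u * u + u * v + v * v) + (2 * (u * s) + u * t + v * s + 2 * (v * t))
    identity′ = solve-∀
    identity″ : ∀ a n → 2 * a + (2 * n + 1) ≡ 2 * (a + n) + 1
    identity″ = solve-∀

  -- The hypothesis says that the form with coefficients a, 2(a + n) + 1, c has discriminant -3.
  -- This undoes the shear on coefficients: a divides n² + n + 1 because (a + n)² + (a + n) + 1
  -- exceeds it by a multiple of a.
  unshear : ∀ a n c → a * c ≡ (a + n) * (a + n) + (a + n) + 1 →
            ∃[ c′ ] a * c′ ≡ n * n + n + 1 × c ≡ c′ + (2 * n + 1) + a
  unshear zero n c eq = contradiction (trans eq (+-comm (n * n + n) 1)) λ ()
  unshear a@(suc _) n c eq = factor a∣n²+n+1
    where
    open ≡-Reasoning
    identity : ∀ a n → (a + n) * (a + n) + (a + n) + 1 ≡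
                       a * (2 * n + 1 + a) + (n * n + n + 1)
    identity = solve-∀
    identity′ : ∀ a n c → a * (2 * n + 1 + a) + c * a ≡ a * (c + (2 * n + 1) + a)
    identity′ = solve-∀

    split : a * c ≡ a * (2 * n + 1 + a) + (n * n + n + 1)
    split = trans eq (identity a n)

    a∣n²+n+1 : a ∣ n * n + n + 1
    a∣n²+n+1 = ∣m+n∣m⇒∣n (subst (a ∣_) split (m∣m*n c)) (m∣m*n (2 * n + 1 + a))

    factor : a ∣ n * n + n + 1 →
             ∃[ c′ ] a * c′ ≡ n * n + n + 1 × c ≡ c′ + (2 * n + 1) + a
    factor (divides c′ eq′) = c′ , trans (*-comm a c′) (sym eq′) , *-cancelˡ-≡ _ _ a (begin
      a * c                                     ≡⟨ split ⟩
      a * (2 * n + 1 + a) + (n * n + n + 1)     ≡⟨ cong (a * (2 * n + 1 + a) +_) eq′ ⟩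
      a * (2 * n + 1 + a) + c′ * a              ≡⟨ identity′ a n c′ ⟩
      a * (c′ + (2 * n + 1) + a)                ∎)

  -- If both a and c exceed n, then (n+1)² ≤ a c forces n = 0; otherwise
  -- subtracting the smaller one from n gives a smaller instance.
  vectors-of-norms : ∀ k n a c → n ≤ k → a * c ≡ n * n + n + 1 → Vectors n a c
  vectors-of-smaller : ∀ k n a c → n ≤ k → a ≤ n → a * c ≡ n * n + n + 1 → Vectors n a c

  vectors-of-norms k n a c n≤k eq with a ≤? n | c ≤? n
  ... | yes a≤n | _ = vectors-of-smaller k n a c n≤k a≤n eq
  ... | no _ | yes c≤n =
    Vectors-sym (vectors-of-smaller k n c a n≤k c≤n (trans (*-comm c a) eq))
  vectors-of-norms k zero a c _ eq | no _ | no _ =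
    -- Here a c = 1, and the standard basis vectors have norm 1 and inner product 1.
    vectors 1 0 0 1 (m*n≡1⇒m≡1 a c eq) (m*n≡1⇒n≡1 a c eq) refl
  vectors-of-norms k n@(suc m) a c _ eq | no a≰n | no c≰n =
    contradiction (*-mono-≤ (≰⇒> a≰n) (≰⇒> c≰n)) (<⇒≱ (begin-strict
      a * c                          ≡⟨ eq ⟩
      n * n + n + 1                  <⟨ m<m+n _ z<s ⟩
      n * n + n + 1 + n              ≡⟨ identity n ⟩
      suc n * suc n                  ∎))
    where
    open ≤-Reasoning
    identity : ∀ n → n * n + n + 1 + n ≡ suc n * suc n
    identity = solve-∀

  vectors-of-smaller k n zero c _ _ eq =
    contradiction (trans eq (+-comm (n * n + n) 1)) λ ()
  vectors-of-smaller zero .zero (suc _) c z≤n () eq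
  -- Since a is positive, n′ = n - a is at most `k`, so the recursion terminates.
  vectors-of-smaller (suc k) n a@(suc a₁) c n≤k a≤n eq
    with n′ , refl ← m≤n⇒∃[o]m+o≡n a≤n =
    let c′ , eq′ , c≡ = unshear a n′ c eq
    in  subst (Vectors n a) (sym c≡) (Vectors-shear
          (vectors-of-norms k n′ a c′ (≤-trans (m≤n+m n′ a₁) (s≤s⁻¹ n≤k)) eq′))

  p≡N : Prime p → p % 3 ≡ 1 → ∃[ u ] ∃[ v ] p ≡ N u v
  p≡N {p} pr p%3≡1 =
    let x , divides q eq = ∣x²+x+1 pr p%3≡1
        vectors u v _ _ norm₁ _ _ =
          vectors-of-norms x x p q ≤-refl (trans (*-comm p q) (sym eq))
    in  u , v , norm₁

  -- Residues modulo 3.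

  d²%3 : ∀ d → d * d % 3 ≡ 0 ⊎ d * d % 3 ≡ 1
  d²%3 d = subst (λ r → r ≡ 0 ⊎ r ≡ 1) (sym (%-distribˡ-* d d 3))
    (on-residues (d % 3) (m%n<n d 3))
    where
    on-residues : ∀ r → r < 3 → r * r % 3 ≡ 0 ⊎ r * r % 3 ≡ 1
    on-residues 0 _ = inj₁ refl
    on-residues 1 _ = inj₂ refl
    on-residues 2 _ = inj₂ refl
    on-residues (suc (suc (suc _))) (s<s (s<s (s<s ())))

  prime∧%3 : Prime p → p % 3 ≡ 0 ⊎ p % 3 ≡ 1 → p ≡ 3 ⊎ p % 3 ≡ 1
  prime∧%3 pr (inj₂ p%3≡1) = inj₂ p%3≡1
  prime∧%3 {p} pr (inj₁ p%3≡0) with prime⇒irreducible pr (m%n≡0⇒n∣m p 3 p%3≡0)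
  ... | inj₂ 3≡p = inj₁ (sym 3≡p)

open import Data.Nat using (ℕ; _%_)
open import Data.Nat.Primality using (Prime)
open import Data.Integer using (ℤ; +_; _+_; _*_; _^_)
open import Data.Product using (Σ-syntax)
open import Data.Sum using (_⊎_)
open import Function.Bundles using (_⇔_)
open import Relation.Binary.PropositionalEquality using (_≡_)

open import Data.Integer using (-[1+_]; ∣_∣; _-_; -_)
open import Data.Integer.Properties using (pos-+; pos-*; +-injective)
open import Data.Integer.Tactic.RingSolver using (solve-∀)
open import Data.Nat.DivMod using ([m+kn]%n≡m%n)
open import Function.Bundles using (mk⇔)
import Data.Nat as ℕ
open NaturalNumbers using (N; p≡N; d²%3; prime∧%3)

-- Passage between natural numbers and integers.

pos-N : ∀ u v → + N u v ≡ (+ u) ^ 2 + + u * + v + (+ v) ^ 2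
pos-N u v = trans (pos-+ (u ℕ.* u ℕ.+ u ℕ.* v) (v ℕ.* v))
  (trans (cong₂ _+_ (trans (pos-+ (u ℕ.* u) (u ℕ.* v)) (cong₂ _+_ (pos-* u u) (pos-* u v)))
                    (pos-* v v))
         (identity (+ u) (+ v)))
  where
  -- a * (a * + 1) is the unfolding of a ^ 2, as the solver does not see through _^_.
  identity : ∀ a b → a * a + a * b + b * b ≡ a * (a * + 1) + a * b + b * (b * + 1)
  identity = solve-∀

∣i∣²≡i² : ∀ i → + (∣ i ∣ ℕ.* ∣ i ∣) ≡ i * i
∣i∣²≡i² (+ n)    = pos-* n n
∣i∣²≡i² -[1+ n ] = refl

-- This rests on n = (a - b)² + 3ab. The sign of ab decides on which side 3|ab| stands, so that the
-- equation can be read in the natural numbers.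
norm%3 : ∀ n a b → + n ≡ a ^ 2 + a * b + b ^ 2 → n % 3 ≡ ∣ a - b ∣ ℕ.* ∣ a - b ∣ % 3
norm%3 n a b eq = by-sign (a * b) refl
  where
  d² : ℕ
  d² = ∣ a - b ∣ ℕ.* ∣ a - b ∣

  n≡d²+3ab : + n ≡ + d² + a * b * + 3
  n≡d²+3ab = trans eq (trans (identity a b) (cong (_+ a * b * + 3) (sym (∣i∣²≡i² (a - b)))))
    where
    identity : ∀ a b → a * (a * + 1) + a * b + b * (b * + 1) ≡ (a - b) * (a - b) + a * b * + 3
    identity = solve-∀

  by-sign : ∀ k → a * b ≡ k → n % 3 ≡ d² % 3
  by-sign (+ k) ab≡k = trans (cong (_% 3) n≡) ([m+kn]%n≡m%n d² k 3)
    where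
    n≡ : n ≡ d² ℕ.+ k ℕ.* 3
    n≡ = +-injective (trans n≡d²+3ab (trans (cong (λ t → + d² + t * + 3) ab≡k)
           (trans (cong (_+_ (+ d²)) (sym (pos-* k 3))) (sym (pos-+ d² (k ℕ.* 3))))))
  by-sign -[1+ k ] ab≡k = sym (trans (cong (_% 3) d²≡) ([m+kn]%n≡m%n n (ℕ.suc k) 3))
    where
    cancel : ∀ i j → i ≡ i + (- j) * + 3 + j * + 3
    cancel = solve-∀

    d²≡ : d² ≡ n ℕ.+ ℕ.suc k ℕ.* 3
    d²≡ = +-injective (trans (cancel (+ d²) (+ ℕ.suc k))
      (trans (cong (λ t → + d² + t * + 3 + + ℕ.suc k * + 3) (sym ab≡k))
      (trans (cong₂ _+_ (sym n≡d²+3ab) (sym (pos-* (ℕ.suc k) 3)))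
             (sym (pos-+ n (ℕ.suc k ℕ.* 3))))))

theoremA : (p : ℕ) → Prime p →
    (Σ[ a ∈ ℤ ] Σ[ b ∈ ℤ ] (+ p ≡ a ^ 2 + a * b + b ^ 2)) ⇔ (p ≡ 3 ⊎ p % 3 ≡ 1)
theoremA p pr = mk⇔ to from
  where
  to : Σ[ a ∈ ℤ ] Σ[ b ∈ ℤ ] (+ p ≡ a ^ 2 + a * b + b ^ 2) → p ≡ 3 ⊎ p % 3 ≡ 1
  to (a , b , eq) = prime∧%3 pr
    (subst (λ r → r ≡ 0 ⊎ r ≡ 1) (sym (norm%3 p a b eq)) (d²%3 ∣ a - b ∣))

  from : p ≡ 3 ⊎ p % 3 ≡ 1 → Σ[ a ∈ ℤ ] Σ[ b ∈ ℤ ] (+ p ≡ a ^ 2 + a * b + b ^ 2)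
  from (inj₁ refl) = + 1 , + 1 , refl
  from (inj₂ p%3≡1) =
    let u , v , eq = p≡N pr p%3≡1
    in  + u , + v , trans (cong +_ eq) (pos-N u v)
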